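{- Let $\mathcal{G}$ be a hereditary graph class that does not contain all clique partition graphs. Then $\mathcal{G}$ is $(\mathrm{tw},\omega)$-bounded if and only if $\mathcal{G}$ has bounded tree-independence number.
   Context: All graphs are finite, simple and undirected. A class is hereditary if it is closed under taking induced subgraphs. A clique partition graph is a disjoint union of complete graphs. A tree decomposition of $G$ is a pair $(T,\{X_t\}_{t\in V(T)})$ with $T$ a tree and bags $X_t\subseteq V(G)$ such that every vertex lies in some bag, every edge has both endpoints in some bag, and for each vertex $v$ the nodes whose bags contain $v$ induce a connected subtree. The tree-independence number $\mathsf{tree}\text{ - }\alpha(G)$ is the minimum over tree decompositions of $\max_t\alpha(G[X_t])$; a class has bounded tree-independence number if some constant bounds it for all members. A class $\mathcal{G}$ is $(\mathrm{tw},\omega)$-bounded if there is a function $f:\mathbb{N}\to\mathbb{N}$ such that for every $G\in\mathcal{G}$ and every induced subgraph $G'$ of $G$, $\mathrm{tw}(G')\le f(\omega(G'))$, where $\mathrm{tw}$ is treewidth and $\omega$ clique number. -}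

module Defs where

open import Data.Nat using (ℕ; zero; suc; _+_; _≤_)
open import Data.Fin using (Fin; inject₁; fromℕ) renaming (zero to fz; suc to fs)
open import Data.Fin.Subset using (Subset; _∈_; _⊆_; ∣_∣)
open import Data.Bool using (Bool; true; false)
open import Data.Product using (Σ; ∃; _×_; _,_)
open import Data.Unit using (⊤)
open import Function.Definitions using (Injective)
open import Relation.Binary.PropositionalEquality using (_≡_)
open import Relation.Nullary using (¬_)

record Graph : Set where
  field
    n     : ℕ
    adj   : Fin n → Fin n → Bool
    sym   : ∀ u v → adj u v ≡ adj v u
    irrefl : ∀ u → adj u u ≡ false
open Graph public

_≤ᵢ_ : Graph → Graph → Set
H ≤ᵢ G = Σ (Fin (n H) → Fin (n G)) λ f →
  Injective _≡_ _≡_ f × (∀ u v → adj H u v ≡ adj G (f u) (f v))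

GraphClass : Set₁
GraphClass = Graph → Set

Hereditary : GraphClass → Set
Hereditary 𝒢 = ∀ G H → 𝒢 G → H ≤ᵢ G → 𝒢 H

-- Disjoint union of complete graphs: vertices are labelled by their
-- component, two distinct vertices adjacent iff in the same component.
IsCliquePartition : Graph → Set
IsCliquePartition G = Σ (Fin (n G) → ℕ) λ c →
  ∀ u v → (adj G u v ≡ true → (¬ u ≡ v) × c u ≡ c v)
        × ((¬ u ≡ v) × c u ≡ c v → adj G u v ≡ true)

data Walk (G : Graph) (S : Fin (n G) → Set) : Fin (n G) → Fin (n G) → Set where
  [_]  : ∀ {x} → S x → Walk G S x x
  step : ∀ {x y z} → S x → adj G x y ≡ true → Walk G S y z → Walk G S x z

ConnectedOn : (G : Graph) → (Fin (n G) → Set) → Set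
ConnectedOn G S = ∀ x y → S x → S y → Walk G S x y

Connected : Graph → Set
Connected G = ConnectedOn G (λ _ → ⊤)

HasCycle : Graph → Set
HasCycle G = Σ ℕ λ k → Σ (Fin (suc (suc (suc k))) → Fin (n G)) λ c →
  Injective _≡_ _≡_ c
  × (∀ (i : Fin (suc (suc k))) → adj G (c (inject₁ i)) (c (fs i)) ≡ true)
  × adj G (c (fromℕ (suc (suc k)))) (c fz) ≡ true

IsTree : Graph → Set
IsTree T = (1 ≤ n T) × Connected T × ¬ HasCycle T

record TreeDecomposition (G : Graph) : Set where
  field
    T       : Graph
    isTree  : IsTree T
    bag     : Fin (n T) → Subset (n G)
    covV    : ∀ v → ∃ λ t → v ∈ bag t
    covE    : ∀ u v → adj G u v ≡ true → ∃ λ t → (u ∈ bag t) × (v ∈ bag t)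
    subtree : ∀ v → ConnectedOn T (λ t → v ∈ bag t)
open TreeDecomposition public

IsClique : (G : Graph) → Subset (n G) → Set
IsClique G S = ∀ u v → u ∈ S → v ∈ S → ¬ u ≡ v → adj G u v ≡ true

IsIndependent : (G : Graph) → Subset (n G) → Set
IsIndependent G S = ∀ u v → u ∈ S → v ∈ S → adj G u v ≡ false

CliqueNumber : (G : Graph) → ℕ → Set
CliqueNumber G w = (Σ (Subset (n G)) λ S → IsClique G S × ∣ S ∣ ≡ w)
                 × (∀ S → IsClique G S → ∣ S ∣ ≤ w)

TwAtMost : Graph → ℕ → Set
TwAtMost G k = Σ (TreeDecomposition G) λ D → ∀ t → ∣ bag D t ∣ ≤ suc k

αAtMost : (G : Graph) → Subset (n G) → ℕ → Set
αAtMost G X k = ∀ S → S ⊆ X → IsIndependent G S → ∣ S ∣ ≤ k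

TreeαAtMost : Graph → ℕ → Set
TreeαAtMost G k = Σ (TreeDecomposition G) λ D → ∀ t → αAtMost G (bag D t) k

BoundedTreeα : GraphClass → Set
BoundedTreeα 𝒢 = Σ ℕ λ k → ∀ G → 𝒢 G → TreeαAtMost G k

TwωBounded : GraphClass → Set
TwωBounded 𝒢 = Σ (ℕ → ℕ) λ f → ∀ G → 𝒢 G → ∀ G' → G' ≤ᵢ G →
  ∀ w → CliqueNumber G' w → TwAtMost G' (f w)

{-# OPTIONS --safe #-}
-- (⇐) By Ramsey's theorem, a bag whose independence number and clique number are bounded has bounded
-- size.
--
-- (⇒) Suppose that 𝒢 omits a clique partition graph H with m vertices and with labels below s. For
-- G ∈ 𝒢, let M be a vertex set with ω(M) ≤ m that has maximum size, and let J be independent and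
-- disjoint from M. Then ω(M ∪ J) ≤ m + 1, so G[M ∪ J] has treewidth at most some constant k. It has no
-- s pairwise anticomplete cliques of size m + 1, since these would contain H. By the Erdős–Pósa
-- property of subtrees of a tree, at most s (k + 1) vertices hit all its cliques of size m + 1. As
-- deleting them from M ∪ J leaves clique number at most m, maximality of M gives |J| ≤ s (k + 1). So
-- adding the complement of M to all bags of a decomposition of G[M] of bounded width gives a
-- decomposition of G whose bags have bounded independence number.
module Submission where

open import Defs
open import Data.Bool using (true; false)
import Data.Bool.Properties as Bool
open import Data.Empty using (⊥; ⊥-elim)
open import Data.Fin using (Fin; inject₁; inject≤; fromℕ; fromℕ<) renaming (zero to fz; suc to fs)
import Data.Fin.Properties as Fin
open import Data.Fin.Subset using (Subset; inside; outside; _∈_; _∉_; _⊆_; _∪_; _∩_; ∁; ⁅_⁆; ∣_∣) renaming (⊥ to ∅)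
open import Data.Fin.Subset.Properties
open import Data.Nat using (ℕ; zero; suc; _+_; _*_; _∸_; _⊔_; _≤_; _<_; z≤n; s≤s; _≤?_; _<?_)
open import Data.Nat.Properties
open import Data.Product using (Σ; ∃; _×_; _,_; proj₁; proj₂)
open import Data.Sum using (_⊎_; inj₁; inj₂)
open import Data.Unit using (tt)
open import Data.Vec using ([]; _∷_; here; there; tabulate)
open import Data.Vec.Functional using () renaming (_∷_ to _◂_)
open import Data.Vec.Properties using (lookup∘tabulate; lookup⇒[]=; []=⇒lookup)
open import Function using (_∘_)
open import Function.Definitions using (Injective)
open import Relation.Binary.PropositionalEquality using (_≡_; _≢_; refl; cong; trans; subst) renaming (sym to ≡-sym)
open import Relation.Nullary using (¬_; Dec; yes; no; does)
open import Relation.Nullary.Decidable using (¬?; _×-dec_; _→-dec_; decidable-stable; dec-true; map′)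
open import Relation.Nullary.Negation using (contradiction)
open import Relation.Unary using (Decidable)

-- Finite subsets

comprehension : ∀ {a} {P : Fin a → Set} → Decidable P → Subset a
comprehension P? = tabulate (does ∘ P?)

∈-comprehension⁺ : ∀ {a} {P : Fin a → Set} (P? : Decidable P) {x} → P x → x ∈ comprehension P?
∈-comprehension⁺ P? {x} px =
  lookup⇒[]= x _ (trans (lookup∘tabulate (does ∘ P?) x) (dec-true (P? x) px))

∈-comprehension⁻ : ∀ {a} {P : Fin a → Set} (P? : Decidable P) {x} → x ∈ comprehension P? → P x
∈-comprehension⁻ P? {x} x∈
  with P? x | trans (≡-sym (lookup∘tabulate (does ∘ P?) x)) ([]=⇒lookup x∈)
... | yes px | _ = px
... | no _   | ()

hasPreimage? : ∀ {a b} (f : Fin a → Fin b) S → Decidable (λ v → ∃ λ i → i ∈ S × f i ≡ v)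
hasPreimage? f S v = Fin.any? λ i → (i ∈? S) ×-dec (f i Fin.≟ v)

image : ∀ {a b} → (Fin a → Fin b) → Subset a → Subset b
image f S = comprehension (hasPreimage? f S)

∈-image⁺ : ∀ {a b} (f : Fin a → Fin b) S {i} → i ∈ S → f i ∈ image f S
∈-image⁺ f S i∈S = ∈-comprehension⁺ (hasPreimage? f S) (_ , i∈S , refl)

∈-image⁻ : ∀ {a b} (f : Fin a → Fin b) S {v} → v ∈ image f S → ∃ λ i → i ∈ S × f i ≡ v
∈-image⁻ f S = ∈-comprehension⁻ (hasPreimage? f S)

preimage : ∀ {a b} → (Fin a → Fin b) → Subset b → Subset a
preimage f S = comprehension λ i → f i ∈? S

∈-preimage⁺ : ∀ {a b} (f : Fin a → Fin b) S {i} → f i ∈ S → i ∈ preimage f S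
∈-preimage⁺ f S = ∈-comprehension⁺ λ i → f i ∈? S

∈-preimage⁻ : ∀ {a b} (f : Fin a → Fin b) S {i} → i ∈ preimage f S → f i ∈ S
∈-preimage⁻ f S = ∈-comprehension⁻ λ i → f i ∈? S

elem : ∀ {a} (p : Subset a) → Fin ∣ p ∣ → Fin a
elem (inside ∷ p)  fz     = fz
elem (inside ∷ p)  (fs i) = fs (elem p i)
elem (outside ∷ p) i      = fs (elem p i)

elem-injective : ∀ {a} (p : Subset a) → Injective _≡_ _≡_ (elem p)
elem-injective (inside ∷ p) {fz} {fz} eq = refl
elem-injective (inside ∷ p) {fs i} {fs j} eq = cong fs (elem-injective p (Fin.suc-injective eq))
elem-injective (outside ∷ p) eq = elem-injective p (Fin.suc-injective eq)

elem∈ : ∀ {a} (p : Subset a) i → elem p i ∈ p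
elem∈ (inside ∷ p)  fz     = here
elem∈ (inside ∷ p)  (fs i) = there (elem∈ p i)
elem∈ (outside ∷ p) i      = there (elem∈ p i)

elem-surjective : ∀ {a} (p : Subset a) {x} → x ∈ p → ∃ λ i → elem p i ≡ x
elem-surjective (inside ∷ p) here = fz , refl
elem-surjective (inside ∷ p) (there x∈p) with elem-surjective p x∈p
... | i , eq = fs i , cong fs eq
elem-surjective (outside ∷ p) (there x∈p) with elem-surjective p x∈p
... | i , eq = i , cong fs eq

-- The map receives the membership proof, since some uses read a chosen preimage off that proof.
-- Enumerating both sets by `elem` reduces the claim to injections between `Fin` types.
∣∣-injection : ∀ {a b} (p : Subset a) (q : Subset b) (f : ∀ {x} → x ∈ p → Fin b)
  → (∀ {x} (x∈p : x ∈ p) → f x∈p ∈ q)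
  → (∀ {x y} (x∈p : x ∈ p) (y∈p : y ∈ p) → f x∈p ≡ f y∈p → x ≡ y)
  → ∣ p ∣ ≤ ∣ q ∣
∣∣-injection p q f f∈q f-inj = Fin.injective⇒≤ {f = g} g-injective
  where
  g : Fin ∣ p ∣ → Fin ∣ q ∣
  g i = proj₁ (elem-surjective q (f∈q (elem∈ p i)))

  elem-g : ∀ i → elem q (g i) ≡ f (elem∈ p i)
  elem-g i = proj₂ (elem-surjective q (f∈q (elem∈ p i)))

  g-injective : Injective _≡_ _≡_ g
  g-injective {i} {j} eq = elem-injective p (f-inj (elem∈ p i) (elem∈ p j)
    (trans (≡-sym (elem-g i)) (trans (cong (elem q) eq) (elem-g j))))

∣image∣≤ : ∀ {a b} (f : Fin a → Fin b) S → ∣ image f S ∣ ≤ ∣ S ∣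
∣image∣≤ f S = ∣∣-injection (image f S) S
  (λ v∈ → proj₁ (∈-image⁻ f S v∈))
  (λ v∈ → proj₁ (proj₂ (∈-image⁻ f S v∈)))
  (λ v∈ w∈ eq → trans (≡-sym (proj₂ (proj₂ (∈-image⁻ f S v∈))))
                  (trans (cong f eq) (proj₂ (proj₂ (∈-image⁻ f S w∈)))))

≤∣image∣ : ∀ {a b} (f : Fin a → Fin b) → Injective _≡_ _≡_ f → ∀ S → ∣ S ∣ ≤ ∣ image f S ∣
≤∣image∣ f f-inj S = ∣∣-injection S (image f S) (λ {x} _ → f x) (∈-image⁺ f S) (λ _ _ → f-inj)

∣p∪q∣≤∣p∣+∣q∣ : ∀ {a} (p q : Subset a) → ∣ p ∪ q ∣ ≤ ∣ p ∣ + ∣ q ∣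
∣p∪q∣≤∣p∣+∣q∣ [] [] = z≤n
∣p∪q∣≤∣p∣+∣q∣ (inside ∷ p) (inside ∷ q) =
  s≤s (≤-trans (∣p∪q∣≤∣p∣+∣q∣ p q) (+-monoʳ-≤ ∣ p ∣ (n≤1+n _)))
∣p∪q∣≤∣p∣+∣q∣ (inside ∷ p) (outside ∷ q) = s≤s (∣p∪q∣≤∣p∣+∣q∣ p q)
∣p∪q∣≤∣p∣+∣q∣ (outside ∷ p) (inside ∷ q) =
  ≤-trans (s≤s (∣p∪q∣≤∣p∣+∣q∣ p q)) (≤-reflexive (≡-sym (+-suc ∣ p ∣ ∣ q ∣)))
∣p∪q∣≤∣p∣+∣q∣ (outside ∷ p) (outside ∷ q) = ∣p∪q∣≤∣p∣+∣q∣ p q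

disjoint⇒∣p∣+∣q∣≤∣p∪q∣ : ∀ {a} (p q : Subset a) → (∀ {x} → x ∈ p → x ∉ q) → ∣ p ∣ + ∣ q ∣ ≤ ∣ p ∪ q ∣
disjoint⇒∣p∣+∣q∣≤∣p∪q∣ [] [] disj = z≤n
disjoint⇒∣p∣+∣q∣≤∣p∪q∣ (inside ∷ p) (inside ∷ q) disj = contradiction here (disj here)
disjoint⇒∣p∣+∣q∣≤∣p∪q∣ (inside ∷ p) (outside ∷ q) disj =
  s≤s (disjoint⇒∣p∣+∣q∣≤∣p∪q∣ p q λ x∈p x∈q → disj (there x∈p) (there x∈q))
disjoint⇒∣p∣+∣q∣≤∣p∪q∣ (outside ∷ p) (inside ∷ q) disj =
  ≤-trans (≤-reflexive (+-suc ∣ p ∣ ∣ q ∣))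
    (s≤s (disjoint⇒∣p∣+∣q∣≤∣p∪q∣ p q λ x∈p x∈q → disj (there x∈p) (there x∈q)))
disjoint⇒∣p∣+∣q∣≤∣p∪q∣ (outside ∷ p) (outside ∷ q) disj =
  disjoint⇒∣p∣+∣q∣≤∣p∪q∣ p q λ x∈p x∈q → disj (there x∈p) (there x∈q)

∣⁅x⁆∪p∣≥ : ∀ {a} {x : Fin a} (p : Subset a) → x ∉ p → suc ∣ p ∣ ≤ ∣ ⁅ x ⁆ ∪ p ∣
∣⁅x⁆∪p∣≥ {x = x} p x∉p = subst (λ c → c + ∣ p ∣ ≤ ∣ ⁅ x ⁆ ∪ p ∣) (∣⁅x⁆∣≡1 x)
  (disjoint⇒∣p∣+∣q∣≤∣p∪q∣ ⁅ x ⁆ p λ y∈ y∈p → x∉p (subst (_∈ p) (x∈⁅y⁆⇒x≡y x y∈) y∈p))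

∣∣-cover : ∀ {a} (S p q : Subset a) → (∀ {x} → x ∈ S → x ∈ p ⊎ x ∈ q) → ∣ S ∣ ≤ ∣ S ∩ p ∣ + ∣ S ∩ q ∣
∣∣-cover S p q cov = ≤-trans (p⊆q⇒∣p∣≤∣q∣ sub) (∣p∪q∣≤∣p∣+∣q∣ (S ∩ p) (S ∩ q))
  where
  sub : S ⊆ (S ∩ p) ∪ (S ∩ q)
  sub x∈S with cov x∈S
  ... | inj₁ x∈p = x∈p∪q⁺ (inj₁ (x∈p∩q⁺ (x∈S , x∈p)))
  ... | inj₂ x∈q = x∈p∪q⁺ (inj₂ (x∈p∩q⁺ (x∈S , x∈q)))

∣∣≤1 : ∀ {a} (p : Subset a) → (∀ {x y} → x ∈ p → y ∈ p → x ≡ y) → ∣ p ∣ ≤ 1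
∣∣≤1 p eq = ∣∣-injection p ⁅ fz {0} ⁆ (λ _ → fz) (λ _ → x∈⁅x⁆ fz) (λ x∈ y∈ _ → eq x∈ y∈)

-- Cliques, independent sets and induced subgraphs

adj⇒≢ : ∀ G {u v} → adj G u v ≡ true → u ≢ v
adj⇒≢ G {u} uv refl with trans (≡-sym uv) (irrefl G u)
... | ()

isClique? : ∀ G → Decidable (IsClique G)
isClique? G S = Fin.all? λ u → Fin.all? λ v →
  (u ∈? S) →-dec ((v ∈? S) →-dec (¬? (u Fin.≟ v) →-dec (adj G u v Bool.≟ true)))

IsClique-⊆ : ∀ G {S S′} → S ⊆ S′ → IsClique G S′ → IsClique G S
IsClique-⊆ G S⊆ cl u v u∈ v∈ = cl u v (S⊆ u∈) (S⊆ v∈)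

IsIndependent-⊆ : ∀ G {S S′} → S ⊆ S′ → IsIndependent G S′ → IsIndependent G S
IsIndependent-⊆ G S⊆ ind u v u∈ v∈ = ind u v (S⊆ u∈) (S⊆ v∈)

ωAtMost : (G : Graph) → Subset (n G) → ℕ → Set
ωAtMost G X m = ∀ S → S ⊆ X → IsClique G S → ∣ S ∣ ≤ m

-- Exhaustive search over subsets; it makes the improvement search in `maximal` decidable.
ωAtMost? : ∀ G m → Decidable (λ X → ωAtMost G X m)
ωAtMost? G m X = map′ bounded unbounded
  (¬? (anySubset? λ S → (S ⊆? X) ×-dec (isClique? G S ×-dec (m <? ∣ S ∣))))
  where
  LargeClique : Subset (n G) → Set
  LargeClique S = S ⊆ X × IsClique G S × m < ∣ S ∣

  bounded : ¬ ∃ LargeClique → ωAtMost G X m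
  bounded none S S⊆X cl = ≮⇒≥ λ m<S → none (S , S⊆X , cl , m<S)

  unbounded : ωAtMost G X m → ¬ ∃ LargeClique
  unbounded ω≤m (S , S⊆X , cl , m<S) = <⇒≱ m<S (ω≤m S S⊆X cl)

clique∩independent≤1 : ∀ G {S I} → IsClique G S → IsIndependent G I → ∣ S ∩ I ∣ ≤ 1
clique∩independent≤1 G {S} {I} cl ind = ∣∣≤1 (S ∩ I) λ {x} {y} x∈ y∈ →
  decidable-stable (x Fin.≟ y) λ x≢y →
    let x∈S , x∈I = x∈p∩q⁻ S I x∈
        y∈S , y∈I = x∈p∩q⁻ S I y∈
    in contradiction (trans (≡-sym (cl x y x∈S y∈S x≢y)) (ind x y x∈I y∈I)) λ ()

image-clique : ∀ {H G} ((f , _) : H ≤ᵢ G) {S} → IsClique H S → IsClique G (image f S)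
image-clique (f , _ , f-adj) {S} cl u v u∈ v∈ u≢v with ∈-image⁻ f S u∈ | ∈-image⁻ f S v∈
... | i , i∈S , refl | j , j∈S , refl = trans (≡-sym (f-adj i j)) (cl i j i∈S j∈S (u≢v ∘ cong f))

preimage-clique : ∀ {H G} ((f , _) : H ≤ᵢ G) {S} → IsClique G S → IsClique H (preimage f S)
preimage-clique (f , f-inj , f-adj) {S} cl i j i∈ j∈ i≢j =
  trans (f-adj i j) (cl (f i) (f j) (∈-preimage⁻ f S i∈) (∈-preimage⁻ f S j∈) (i≢j ∘ f-inj))

induced : (G : Graph) → Subset (n G) → Graph
induced G W = record
  { n      = ∣ W ∣
  ; adj    = λ u v → adj G (elem W u) (elem W v)
  ; sym    = λ u v → sym G (elem W u) (elem W v)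
  ; irrefl = λ u → irrefl G (elem W u)
  }

induced-≤ᵢ : ∀ G W → induced G W ≤ᵢ G
induced-≤ᵢ G W = elem W , elem-injective W , λ _ _ → refl

induced-ω : ∀ G W {m} → ωAtMost G W m → ∀ S → IsClique (induced G W) S → ∣ S ∣ ≤ m
induced-ω G W ω≤m S cl = ≤-trans (≤∣image∣ (elem W) (elem-injective W) S)
  (ω≤m (image (elem W) S) image⊆W (image-clique {induced G W} {G} (induced-≤ᵢ G W) cl))
  where
  image⊆W : image (elem W) S ⊆ W
  image⊆W v∈ with ∈-image⁻ (elem W) S v∈
  ... | i , _ , refl = elem∈ W i

-- `TwωBounded` asks for the exact clique number. Lower the bound until some clique attains it; at
-- zero the empty clique does.
cliqueNumber≤ : ∀ G m → (∀ S → IsClique G S → ∣ S ∣ ≤ m) → Σ ℕ λ w → w ≤ m × CliqueNumber G w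
cliqueNumber≤ G m bound with anySubset? (λ S → isClique? G S ×-dec (∣ S ∣ ≟ m))
... | yes attained = m , ≤-refl , attained , bound
cliqueNumber≤ G zero bound | no none =
  contradiction (∅ , (λ u v u∈ → contradiction u∈ ∉⊥) , ∣⊥∣≡0 (n G)) none
cliqueNumber≤ G (suc m) bound | no none
  with cliqueNumber≤ G m (λ S cl → ≤-pred (≤∧≢⇒< (bound S cl) λ eq → none (S , cl , eq)))
... | w , w≤m , cn = w , m≤n⇒m≤1+n w≤m , cn

-- Ramsey's theorem

-- In closed form, the binomial coefficient "a + b choose a" minus one.
ramseyBound : ℕ → ℕ → ℕ
ramseyBound zero    b       = 0
ramseyBound (suc a) zero    = 0
ramseyBound (suc a) (suc b) = suc (ramseyBound a (suc b) + ramseyBound (suc a) b)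

m+n≤o+p⇒m≤o⊎n≤p : ∀ m n o p → m + n ≤ o + p → m ≤ o ⊎ n ≤ p
m+n≤o+p⇒m≤o⊎n≤p m n o p le with m ≤? o | n ≤? p
... | yes m≤o | _       = inj₁ m≤o
... | no _    | yes n≤p = inj₂ n≤p
... | no m≰o  | no n≰p  = contradiction le (<⇒≱ (+-mono-< (≰⇒> m≰o) (≰⇒> n≰p)))

insert-clique : ∀ G {v S} → (∀ {u} → u ∈ S → adj G v u ≡ true) → IsClique G S → IsClique G (⁅ v ⁆ ∪ S)
insert-clique G {v} {S} complete cl x y x∈ y∈ x≢y with x∈p∪q⁻ ⁅ v ⁆ S x∈ | x∈p∪q⁻ ⁅ v ⁆ S y∈
... | inj₂ x∈S | inj₂ y∈S = cl x y x∈S y∈S x≢y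
... | inj₁ x∈v | inj₂ y∈S rewrite x∈⁅y⁆⇒x≡y v x∈v = complete y∈S
... | inj₂ x∈S | inj₁ y∈v rewrite x∈⁅y⁆⇒x≡y v y∈v = trans (sym G x v) (complete x∈S)
... | inj₁ x∈v | inj₁ y∈v = contradiction (trans (x∈⁅y⁆⇒x≡y v x∈v) (≡-sym (x∈⁅y⁆⇒x≡y v y∈v))) x≢y

insert-independent : ∀ G {v S} → (∀ {u} → u ∈ S → adj G v u ≡ false) → IsIndependent G S
  → IsIndependent G (⁅ v ⁆ ∪ S)
insert-independent G {v} {S} anti ind x y x∈ y∈ with x∈p∪q⁻ ⁅ v ⁆ S x∈ | x∈p∪q⁻ ⁅ v ⁆ S y∈
... | inj₂ x∈S | inj₂ y∈S = ind x y x∈S y∈S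
... | inj₁ x∈v | inj₂ y∈S rewrite x∈⁅y⁆⇒x≡y v x∈v = anti y∈S
... | inj₂ x∈S | inj₁ y∈v rewrite x∈⁅y⁆⇒x≡y v y∈v = trans (sym G x v) (anti x∈S)
... | inj₁ x∈v | inj₁ y∈v rewrite x∈⁅y⁆⇒x≡y v x∈v | x∈⁅y⁆⇒x≡y v y∈v = irrefl G v

-- Fix a vertex `v` of `X`. The other vertices split into neighbours and non-neighbours of `v`; one
-- side reaches its recursive bound, and `v` can be added to the smaller clique or independent set
-- found there.
ramsey : ∀ G a b X → ramseyBound a b ≤ ∣ X ∣
  → (Σ (Subset (n G)) λ S → S ⊆ X × IsClique G S × a ≤ ∣ S ∣)
  ⊎ (Σ (Subset (n G)) λ S → S ⊆ X × IsIndependent G S × b ≤ ∣ S ∣)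
ramsey G zero b X _ =
  inj₁ (∅ , (λ x∈ → contradiction x∈ ∉⊥) , (λ u v u∈ → contradiction u∈ ∉⊥) , z≤n)
ramsey G (suc a) zero X _ =
  inj₂ (∅ , (λ x∈ → contradiction x∈ ∉⊥) , (λ u v u∈ → contradiction u∈ ∉⊥) , z≤n)
ramsey G (suc a) (suc b) X R≤X = branch (m+n≤o+p⇒m≤o⊎n≤p _ _ _ _ split)
  where
  v : Fin (n G)
  v = elem X (fromℕ< (≤-trans (s≤s z≤n) R≤X))

  v∈X : v ∈ X
  v∈X = elem∈ X _

  N? : Decidable (λ u → adj G v u ≡ true)
  N? u = adj G v u Bool.≟ true

  N̄? : Decidable (λ u → adj G v u ≡ false × u ≢ v)
  -- `v` is not its own neighbour, so it is excluded explicitly: it must be new when added to an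
  -- independent set.
  N̄? u = (adj G v u Bool.≟ false) ×-dec ¬? (u Fin.≟ v)

  N N̄ : Subset (n G)
  N = comprehension N?
  N̄ = comprehension N̄?

  cover : X ⊆ ⁅ v ⁆ ∪ ((X ∩ N) ∪ (X ∩ N̄))
  cover {x} x∈X with x Fin.≟ v | adj G v x in eq
  ... | yes refl | _ = x∈p∪q⁺ (inj₁ (x∈⁅x⁆ v))
  ... | no _ | true =
    x∈p∪q⁺ (inj₂ (x∈p∪q⁺ (inj₁ (x∈p∩q⁺ (x∈X , ∈-comprehension⁺ N? eq)))))
  ... | no x≢v | false =
    x∈p∪q⁺ (inj₂ (x∈p∪q⁺ (inj₂ (x∈p∩q⁺ (x∈X , ∈-comprehension⁺ N̄? (eq , x≢v))))))

  split : ramseyBound a (suc b) + ramseyBound (suc a) b ≤ ∣ X ∩ N ∣ + ∣ X ∩ N̄ ∣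
  split = ≤-pred (begin
    suc (ramseyBound a (suc b) + ramseyBound (suc a) b) ≤⟨ R≤X ⟩
    ∣ X ∣                                               ≤⟨ p⊆q⇒∣p∣≤∣q∣ cover ⟩
    ∣ ⁅ v ⁆ ∪ ((X ∩ N) ∪ (X ∩ N̄)) ∣                     ≤⟨ ∣p∪q∣≤∣p∣+∣q∣ ⁅ v ⁆ _ ⟩
    ∣ ⁅ v ⁆ ∣ + ∣ (X ∩ N) ∪ (X ∩ N̄) ∣                   ≡⟨ cong (_+ ∣ (X ∩ N) ∪ (X ∩ N̄) ∣) (∣⁅x⁆∣≡1 v) ⟩
    suc ∣ (X ∩ N) ∪ (X ∩ N̄) ∣                           ≤⟨ s≤s (∣p∪q∣≤∣p∣+∣q∣ (X ∩ N) (X ∩ N̄)) ⟩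
    suc (∣ X ∩ N ∣ + ∣ X ∩ N̄ ∣)                         ∎)
    where open ≤-Reasoning

  insert⊆ : ∀ {S Y} → S ⊆ X ∩ Y → ⁅ v ⁆ ∪ S ⊆ X
  insert⊆ {S} {Y} S⊆ x∈ with x∈p∪q⁻ ⁅ v ⁆ S x∈
  ... | inj₁ x∈v rewrite x∈⁅y⁆⇒x≡y v x∈v = v∈X
  ... | inj₂ x∈S = proj₁ (x∈p∩q⁻ X Y (S⊆ x∈S))

  branch : ramseyBound a (suc b) ≤ ∣ X ∩ N ∣ ⊎ ramseyBound (suc a) b ≤ ∣ X ∩ N̄ ∣
    → (Σ (Subset (n G)) λ S → S ⊆ X × IsClique G S × suc a ≤ ∣ S ∣)
    ⊎ (Σ (Subset (n G)) λ S → S ⊆ X × IsIndependent G S × suc b ≤ ∣ S ∣)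
  branch (inj₁ le) with ramsey G a (suc b) (X ∩ N) le
  ... | inj₂ (S , S⊆ , ind , b<S) = inj₂ (S , proj₁ ∘ x∈p∩q⁻ X N ∘ S⊆ , ind , b<S)
  ... | inj₁ (S , S⊆ , cl , a≤S) =
    inj₁ (⁅ v ⁆ ∪ S , insert⊆ S⊆ , insert-clique G nbr cl
         , ≤-trans (s≤s a≤S) (∣⁅x⁆∪p∣≥ S λ v∈S → adj⇒≢ G (nbr v∈S) refl))
    where
    nbr : ∀ {u} → u ∈ S → adj G v u ≡ true
    nbr u∈S = ∈-comprehension⁻ N? (proj₂ (x∈p∩q⁻ X N (S⊆ u∈S)))
  branch (inj₂ le) with ramsey G (suc a) b (X ∩ N̄) le
  ... | inj₁ (S , S⊆ , cl , a<S) = inj₁ (S , proj₁ ∘ x∈p∩q⁻ X N̄ ∘ S⊆ , cl , a<S)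
  ... | inj₂ (S , S⊆ , ind , b≤S) =
    inj₂ (⁅ v ⁆ ∪ S , insert⊆ S⊆ , insert-independent G (proj₁ ∘ nonnbr) ind
         , ≤-trans (s≤s b≤S) (∣⁅x⁆∪p∣≥ S λ v∈S → proj₂ (nonnbr v∈S) refl))
    where
    nonnbr : ∀ {u} → u ∈ S → adj G v u ≡ false × u ≢ v
    nonnbr u∈S = ∈-comprehension⁻ N̄? (proj₂ (x∈p∩q⁻ X N̄ (S⊆ u∈S)))

-- Bounded tree-independence number implies (tw, ω)-boundedness

boundedTreeα⇒twωBounded : ∀ 𝒢 → Hereditary 𝒢 → BoundedTreeα 𝒢 → TwωBounded 𝒢
boundedTreeα⇒twωBounded 𝒢 her (k , treeα) = f , bounded
  where
  f : ℕ → ℕ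
  -- Both arguments exceed the allowed sizes by one, so either Ramsey outcome in a bag is
  -- contradictory.
  f w = ramseyBound (suc w) (suc k)

  bounded : ∀ G → 𝒢 G → ∀ G′ → G′ ≤ᵢ G → ∀ w → CliqueNumber G′ w → TwAtMost G′ (f w)
  bounded G G∈ G′ G′≤G w (_ , ω≤w) with treeα G′ (her G G′ G∈ G′≤G)
  ... | D , α≤k = D , λ t → m≤n⇒m≤1+n (≰⇒≥ (small t))
    where
    small : ∀ t → ¬ (f w ≤ ∣ bag D t ∣)
    small t le with ramsey G′ (suc w) (suc k) (bag D t) le
    ... | inj₁ (S , _ , cl , w<S)  = <⇒≱ w<S (ω≤w S cl)
    ... | inj₂ (S , S⊆ , ind , k<S) = <⇒≱ k<S (α≤k t S S⊆ ind)

-- Walks, paths and cycles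

module _ {G : Graph} where

  source : ∀ {S x y} → Walk G S x y → S x
  source [ sx ]        = sx
  source (step sx _ _) = sx

  target : ∀ {S x y} → Walk G S x y → S y
  target [ sx ]       = sx
  target (step _ _ w) = target w

  mapWalk : ∀ {S S′ : Fin (n G) → Set} {x y} → (∀ {v} → S v → S′ v) → Walk G S x y → Walk G S′ x y
  mapWalk f [ sx ]        = [ f sx ]
  mapWalk f (step sx a w) = step (f sx) a (mapWalk f w)

  infixr 5 _++_
  _++_ : ∀ {S x y z} → Walk G S x y → Walk G S y z → Walk G S x z
  [ _ ]       ++ w′ = w′
  step sx a w ++ w′ = step sx a (w ++ w′)

  reverse : ∀ {S x y} → Walk G S x y → Walk G S y x
  reverse [ sx ] = [ sx ]
  reverse (step {x} {y} sx a w) = reverse w ++ step (source w) (trans (sym G y x) a) [ sx ]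

  -- Its second outcome finds the neighbour through which `t` is entered; in the descent below this
  -- is the child of `t` to move to.
  beforeFirstVisit : ∀ {S x z} t → Walk G S x z → x ≢ t
    → Walk G (λ v → S v × v ≢ t) x z
    ⊎ ∃ λ u → adj G u t ≡ true × Walk G (λ v → S v × v ≢ t) x u
  beforeFirstVisit t [ sx ] x≢t = inj₁ [ sx , x≢t ]
  beforeFirstVisit t (step {x} {y} sx a w) x≢t with y Fin.≟ t
  ... | yes refl = inj₂ (x , a , [ sx , x≢t ])
  ... | no y≢t with beforeFirstVisit t w y≢t
  ...   | inj₁ w′           = inj₁ (step (sx , x≢t) a w′)
  ...   | inj₂ (u , a′ , w′) = inj₂ (u , a′ , step (sx , x≢t) a w′)

  -- Vertices are indexed as in `HasCycle`, so that prepending one vertex to a path can yield a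
  -- cycle directly.
  record Path (S : Fin (n G) → Set) (x z : Fin (n G)) : Set where
    field
      len       : ℕ
      vertex    : Fin (suc len) → Fin (n G)
      injective : Injective _≡_ _≡_ vertex
      edges     : ∀ (i : Fin len) → adj G (vertex (inject₁ i)) (vertex (fs i)) ≡ true
      starts    : vertex fz ≡ x
      ends      : vertex (fromℕ len) ≡ z
      within    : ∀ i → S (vertex i)
  open Path

  ◂-injective : ∀ {a} {x : Fin (n G)} {p : Fin a → Fin (n G)} → (∀ i → x ≢ p i)
    → Injective _≡_ _≡_ p → Injective _≡_ _≡_ (x ◂ p)
  ◂-injective x∉p p-inj {fz}   {fz}   eq = refl
  ◂-injective x∉p p-inj {fz}   {fs j} eq = contradiction eq (x∉p j)
  ◂-injective x∉p p-inj {fs i} {fz}   eq = contradiction (≡-sym eq) (x∉p i)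
  ◂-injective x∉p p-inj {fs i} {fs j} eq = cong fs (p-inj eq)

  -- Removes a repetition: if the vertex to be prepended is already on the path, the path is
  -- restarted from there.
  suffix : ∀ {S z} l (p : Fin (suc l) → Fin (n G)) → Injective _≡_ _≡_ p
    → (∀ (i : Fin l) → adj G (p (inject₁ i)) (p (fs i)) ≡ true)
    → p (fromℕ l) ≡ z → (∀ i → S (p i)) → ∀ i → Path S (p i) z
  suffix l p inj es end ins fz = record
    { len = l ; vertex = p ; injective = inj ; edges = es ; starts = refl ; ends = end ; within = ins }
  suffix (suc l) p inj es end ins (fs i) =
    suffix l (p ∘ fs) (Fin.suc-injective ∘ inj) (es ∘ fs) end (ins ∘ fs) i

  walk⇒path : ∀ {S x z} → Walk G S x z → Path S x z
  walk⇒path {x = x} [ sx ] = record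
    { len = 0 ; vertex = λ _ → x ; injective = λ { {fz} {fz} _ → refl } ; edges = λ ()
    ; starts = refl ; ends = refl ; within = λ _ → sx }
  walk⇒path {S} {x} {z} (step sx a w) with walk⇒path w
  ... | p with Fin.any? (λ i → vertex p i Fin.≟ x)
  ...   | yes (i , eq) = subst (λ y → Path S y z) eq
          (suffix (len p) (vertex p) (injective p) (edges p) (ends p) (within p) i)
  ...   | no x∉p = record
          { len       = suc (len p)
          ; vertex    = x ◂ vertex p
          ; injective = ◂-injective (λ i eq → x∉p (i , ≡-sym eq)) (injective p)
          ; edges     = λ { fz → subst (λ y → adj G x y ≡ true) (≡-sym (starts p)) a ; (fs i) → edges p i }
          ; starts    = refl
          ; ends      = ends p
          ; within    = λ { fz → sx ; (fs i) → within p i }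
          }

  -- A path from `u` to `v` with at least one edge closes up through `t` to a cycle on at least
  -- three vertices, so the path must be trivial.
  acyclic⇒sameNeighbour : ¬ HasCycle G → ∀ {t u v} → adj G u t ≡ true → adj G v t ≡ true
    → Walk G (_≢ t) u v → u ≡ v
  acyclic⇒sameNeighbour acyclic {t} {u} {v} ut vt w = closeUp (walk⇒path w)
    where
    closeUp : Path (_≢ t) u v → u ≡ v
    closeUp record { len = zero ; starts = starts ; ends = ends } = trans (≡-sym starts) ends
    closeUp record { len = suc k ; vertex = p ; injective = inj ; edges = es ; starts = refl ; ends = refl ; within = ins } =
      contradiction
        ( k , t ◂ p , (λ {i} {j} → ◂-injective (λ i eq → ins i (≡-sym eq)) inj {i} {j})
        , (λ { fz → trans (sym G t (p fz)) ut ; (fs i) → es i }) , vt )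
        acyclic

-- The Erdős–Pósa property for cliques in a tree decomposition

Anticomplete : (G : Graph) → Subset (n G) → Subset (n G) → Set
Anticomplete G K K′ = ∀ {u v} → u ∈ K → v ∈ K′ → u ≢ v × adj G u v ≡ false

anticomplete-sym : ∀ G {K K′} → Anticomplete G K K′ → Anticomplete G K′ K
anticomplete-sym G anti {u} {v} u∈ v∈ with anti v∈ u∈
... | v≢u , vu = v≢u ∘ ≡-sym , trans (sym G u v) vu

PairwiseAnticomplete : (G : Graph) (s : ℕ) → (Subset (n G) → Set) → Set
PairwiseAnticomplete G s F = Σ (Fin s → Subset (n G)) λ K →
  (∀ i → F (K i)) × (∀ i j → i ≢ j → Anticomplete G (K i) (K j))

module _ {G : Graph} (D : TreeDecomposition G) where

  Hits : Subset (n G) → Fin (n (T D)) → Set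
  Hits K t = ∃ λ v → v ∈ K × v ∈ bag D t

  hits? : ∀ K → Decidable (Hits K)
  hits? K t = Fin.any? λ v → (v ∈? K) ×-dec (v ∈? bag D t)

  -- The subtrees of two members of a clique meet in a node whose bag covers their edge, so the
  -- union of these subtrees is connected.
  hits-connected : ∀ {K} → IsClique G K → ConnectedOn (T D) (Hits K)
  hits-connected {K} cl x y (u , u∈K , u∈x) (v , v∈K , v∈y) with u Fin.≟ v
  ... | yes refl = mapWalk (λ u∈ → u , u∈K , u∈) (subtree D u x y u∈x v∈y)
  ... | no u≢v with covE D u v (cl u v u∈K v∈K u≢v)
  ...   | z , u∈z , v∈z =
    mapWalk (λ u∈ → u , u∈K , u∈) (subtree D u x z u∈x u∈z)
    ++ mapWalk (λ v∈ → v , v∈K , v∈) (subtree D v z y v∈z v∈y)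

  Touching : Subset (n G) → Subset (n G) → Set
  Touching K K′ = ∃ λ t → Hits K t × Hits K′ t

  -- A common vertex, or an edge between the two sets, lies in some bag, and both sets hit that
  -- node.
  ¬touching⇒anticomplete : ∀ {K K′} → ¬ Touching K K′ → Anticomplete G K K′
  ¬touching⇒anticomplete ¬touch {u} {v} u∈K v∈K′ = u≢v , nonadjacent
    where
    u≢v : u ≢ v
    u≢v refl = let t , u∈t = covV D u in ¬touch (t , (u , u∈K , u∈t) , (u , v∈K′ , u∈t))

    nonadjacent : adj G u v ≡ false
    nonadjacent with adj G u v in eq
    ... | false = refl
    ... | true  = let t , u∈t , v∈t = covE D u v eq in
      contradiction (t , (u , u∈K , u∈t) , (v , v∈K′ , v∈t)) ¬touch

  root : Fin (n (T D))
  root = fromℕ< (proj₁ (isTree D))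

  -- The negation of EscapesAvoiding t says that a node lies in the subtree rooted at t.
  EscapesAvoiding : Fin (n (T D)) → Fin (n (T D)) → Set
  EscapesAvoiding t x = Walk (T D) (_≢ t) x root

  -- A walk to the root that avoids `t` cannot pass through `t′`, since its remainder from there
  -- would let `t′` escape `t`.
  escapes-mono : ∀ {t t′ x} → ¬ EscapesAvoiding t t′ → EscapesAvoiding t x → EscapesAvoiding t′ x
  escapes-mono ¬esc [ sx ]          = [ (λ { refl → ¬esc [ sx ] }) ]
  escapes-mono ¬esc w@(step sx a w′) = step (λ { refl → ¬esc w }) a (escapes-mono ¬esc w′)

  -- If K lies below t, then a clique of F that touches K but does not hit t lies strictly below t, so
  -- one can descend to the child t′ of t towards it. The nodes left behind escape t′, hence are never
  -- revisited and the descent ends.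
  separatingNode : (F : Subset (n G) → Set) → (∀ {K} → F K → IsClique G K) → ∃ F
    → ¬ ¬ ∃ λ K → F K × ∃ λ t → ∀ K′ → F K′ → Touching K K′ → Hits K′ t
  separatingNode F clique (K₀ , FK₀) none =
    descend (n (T D)) root ∅ (m≤n+m _ _) (λ v v∈ → contradiction v∈ ∉⊥) (inj₁ refl) K₀ FK₀
      (λ x _ esc → target esc refl)
    where
    descend : ∀ fuel t (V : Subset (n (T D))) → n (T D) ≤ ∣ V ∣ + fuel
      → (∀ v → v ∈ V → EscapesAvoiding t v)
      -- Here `u` plays the parent of `t`. The set `V` collects the nodes left behind.
      → t ≡ root ⊎ (∃ λ u → adj (T D) t u ≡ true × EscapesAvoiding t u)
      → ∀ K → F K → (∀ x → Hits K x → ¬ EscapesAvoiding t x) → ⊥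
    descend zero t V n≤V visited parent K FK below =
      -- Without fuel `V` contains all nodes, but `t` is not in `V`: no walk avoiding `t` starts at
      -- `t`.
      <⇒≱ (≤-trans (∣⁅x⁆∪p∣≥ V (λ t∈V → source (visited t t∈V) refl)) (∣p∣≤n (⁅ t ⁆ ∪ V)))
          (subst (n (T D) ≤_) (+-identityʳ ∣ V ∣) n≤V)
    descend (suc fuel) t V n≤V visited parent K FK below =
      none (K , FK , t , λ K′ FK′ (x , Kx , K′x) →
        decidable-stable (hits? K′ t) λ ¬K′t → continue K′ FK′ x Kx K′x ¬K′t)
      where
      continue : ∀ K′ → F K′ → ∀ x → Hits K x → Hits K′ x → ¬ Hits K′ t → ⊥
      continue K′ FK′ x Kx K′x ¬K′t
        with beforeFirstVisit t (proj₁ (proj₂ (isTree D)) x t tt tt) (λ { refl → ¬K′t K′x })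
      ... | inj₁ w = proj₂ (target w) refl
      ... | inj₂ (t′ , t′t , w) =
        descend fuel t′ (⁅ t ⁆ ∪ V) fuel-ok visited′ (inj₂ (t , t′t , escapes-t parent)) K′ FK′ below′
        where
        avoids : ∀ {y} → Hits K′ y → y ≢ t
        avoids K′y refl = ¬K′t K′y

        x⇝t′ : Walk (T D) (_≢ t) x t′
        x⇝t′ = mapWalk proj₂ w

        t′-below : ¬ EscapesAvoiding t t′
        t′-below esc = below x Kx (x⇝t′ ++ esc)

        x⇝ : ∀ y → Hits K′ y → Walk (T D) (_≢ t) x y
        x⇝ y K′y = mapWalk avoids (hits-connected (clique FK′) x y K′x K′y)

        escapes-t : t ≡ root ⊎ (∃ λ u → adj (T D) t u ≡ true × EscapesAvoiding t u) → EscapesAvoiding t′ t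
        escapes-t (inj₁ refl)           = [ adj⇒≢ (T D) t′t ∘ ≡-sym ]
        escapes-t (inj₂ (u , tu , esc)) =
          step (adj⇒≢ (T D) t′t ∘ ≡-sym) tu (escapes-mono t′-below esc)

        visited′ : ∀ v → v ∈ ⁅ t ⁆ ∪ V → EscapesAvoiding t′ v
        visited′ v v∈ with x∈p∪q⁻ ⁅ t ⁆ V v∈
        ... | inj₁ v∈t rewrite x∈⁅y⁆⇒x≡y t v∈t = escapes-t parent
        ... | inj₂ v∈V = escapes-mono t′-below (visited v v∈V)

        fuel-ok : n (T D) ≤ ∣ ⁅ t ⁆ ∪ V ∣ + fuel
        fuel-ok = ≤-trans (subst (n (T D) ≤_) (+-suc ∣ V ∣ fuel) n≤V)
          (+-monoˡ-≤ fuel (∣⁅x⁆∪p∣≥ V (λ t∈V → source (visited t t∈V) refl)))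

        below′ : ∀ y → Hits K′ y → ¬ EscapesAvoiding t′ y
        below′ y K′y esc with beforeFirstVisit t esc (avoids K′y)
        -- If the escaping walk from `y` also avoids `t`, then `x` escapes `t` by way of `y`.
        ... | inj₁ w′ = below x Kx (x⇝ y K′y ++ mapWalk proj₂ w′)
        -- Otherwise it enters `t` from a neighbour `u` other than `t′`. But `t′` and `u` are joined
        -- off `t` through `x` and `y`, against acyclicity.
        ... | inj₂ (u , ut , w′) = proj₁ (target w′) (≡-sym
          (acyclic⇒sameNeighbour (proj₂ (proj₂ (isTree D))) t′t ut
            (reverse x⇝t′ ++ x⇝ y K′y ++ mapWalk proj₂ w′)))

  -- Induction on `s`: take `K` and `t` from `separatingNode`. Members of `F` that miss the bag at
  -- `t` do not touch `K`, so `K` extends every anticomplete family among them; they are hit by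
  -- induction, and the bag hits the rest. As `F` is an arbitrary predicate, its members cannot be
  -- searched, whence the double negation.
  erdősPósa : ∀ {k} → (∀ t → ∣ bag D t ∣ ≤ k) → ∀ s (F : Subset (n G) → Set)
    → (∀ {K} → F K → IsClique G K) → ¬ PairwiseAnticomplete G s F
    → ¬ ¬ Σ (Subset (n G)) λ Z → ∣ Z ∣ ≤ s * k × (∀ K → F K → ∃ λ v → v ∈ K × v ∈ Z)
  erdősPósa width zero F clique none _ = none ((λ ()) , (λ ()) , (λ ()))
  erdősPósa {k} width (suc s) F clique none noZ =
    -- It suffices to refute `∃ F`, as the empty set hits an empty family.
    noZ (∅ , subst (_≤ suc s * k) (≡-sym (∣⊥∣≡0 (n G))) z≤n , λ K FK → ⊥-elim (nonempty (K , FK)))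
    where
    nonempty : ∃ F → ⊥
    nonempty ∃F = separatingNode F clique ∃F λ (K , FK , t , sep) →
      let F′ : Subset (n G) → Set
          F′ K′ = F K′ × ¬ Hits K′ t

          far : ∀ {K′} → F′ K′ → Anticomplete G K K′
          far (FK′ , ¬K′t) = ¬touching⇒anticomplete λ touch → ¬K′t (sep _ FK′ touch)

          none′ : ¬ PairwiseAnticomplete G s F′
          none′ = λ (Ks , F′Ks , anti) → none
            ( K ◂ Ks
            , (λ { fz → FK ; (fs i) → proj₁ (F′Ks i) })
            , λ { fz     fz     i≢i → contradiction refl i≢i
                ; fz     (fs j) _   → far (F′Ks j)
                ; (fs i) fz     _   → anticomplete-sym G (far (F′Ks i))
                ; (fs i) (fs j) i≢j → anti i j (i≢j ∘ cong fs) } )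
      in erdősPósa width s F′ (clique ∘ proj₁) none′ λ (Z , Z≤ , hit) →
        noZ ( bag D t ∪ Z
            , ≤-trans (∣p∪q∣≤∣p∣+∣q∣ (bag D t) Z) (+-mono-≤ (width t) Z≤)
            , λ K′ FK′ → hitBy Z t K′ FK′ hit (hits? K′ t) )
      where
      hitBy : ∀ Z t K′ → F K′ → (∀ K → F K × ¬ Hits K t → ∃ λ v → v ∈ K × v ∈ Z) → Dec (Hits K′ t)
        → ∃ λ v → v ∈ K′ × v ∈ bag D t ∪ Z
      hitBy Z t K′ FK′ hit (yes (v , v∈K′ , v∈t)) = v , v∈K′ , x∈p∪q⁺ (inj₁ v∈t)
      hitBy Z t K′ FK′ hit (no ¬K′t) with hit K′ (FK′ , ¬K′t)
      ... | v , v∈K′ , v∈Z = v , v∈K′ , x∈p∪q⁺ (inj₂ v∈Z)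

-- Graph classes omitting a clique partition graph

labels<bound : ∀ {a} (c : Fin a → ℕ) → Σ ℕ λ s → ∀ v → c v < s
labels<bound {zero} c = 0 , λ ()
labels<bound {suc a} c with labels<bound (c ∘ fs)
... | s , c<s = suc (c fz) ⊔ s , λ
  { fz     → m≤m⊔n (suc (c fz)) s
  ; (fs v) → ≤-trans (c<s v) (m≤n⊔m (suc (c fz)) s) }

-- Each component of `H` goes into its own clique. Every clique has room for all of `H`, so vertex
-- `v` can take the `v`-th place whatever its component.
embedCliquePartition : ∀ H G ((c , _) : IsCliquePartition H) s → (∀ v → c v < s)
  → PairwiseAnticomplete G s (λ K → IsClique G K × n H ≤ ∣ K ∣) → H ≤ᵢ G
embedCliquePartition H G (c , partition) s c<s (K , FK , anti) = f , f-injective , f-adj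
  where
  part : Fin (n H) → Fin s
  part v = fromℕ< (c<s v)

  part-cong : ∀ {u v} → c u ≡ c v → part u ≡ part v
  part-cong eq = Fin.fromℕ<-cong _ _ eq _ _

  part-reflects : ∀ {u v} → part u ≡ part v → c u ≡ c v
  part-reflects = Fin.fromℕ<-injective _ _ _ _

  place : Fin s → Fin (n H) → Fin (n G)
  place i v = elem (K i) (inject≤ v (proj₂ (FK i)))

  place∈ : ∀ i v → place i v ∈ K i
  place∈ i v = elem∈ (K i) _

  f : Fin (n H) → Fin (n G)
  f v = place (part v) v

  f-injective : Injective _≡_ _≡_ f
  f-injective {u} {v} eq with part u Fin.≟ part v
  ... | no pu≢pv = contradiction eq (proj₁ (anti _ _ pu≢pv (place∈ _ u) (place∈ _ v)))
  ... | yes pu≡pv = Fin.inject≤-injective _ _ u v (elem-injective (K (part v))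
    (trans (cong (λ i → place i u) (≡-sym pu≡pv)) eq))

  f-adj : ∀ u v → adj H u v ≡ adj G (f u) (f v)
  f-adj u v with u Fin.≟ v | c u ≟ c v
  ... | yes refl | _ = trans (irrefl H u) (≡-sym (irrefl G (f u)))
  ... | no u≢v | yes cu≡cv = trans (proj₂ (partition u v) (u≢v , cu≡cv)) (≡-sym
    (proj₁ (FK (part v)) (f u) (f v) (subst (λ i → f u ∈ K i) (part-cong cu≡cv) (place∈ _ u))
      (place∈ _ v) (u≢v ∘ f-injective)))
  ... | no u≢v | no cu≢cv = trans
    (Bool.¬-not (λ uv → cu≢cv (proj₂ (proj₁ (partition u v) uv))))
    (≡-sym (proj₂ (anti _ _ (cu≢cv ∘ part-reflects) (place∈ _ u) (place∈ _ v))))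

-- The given `f` may fail to be monotone and speaks of exact clique numbers; its running maximum
-- serves for upper bounds.
twωBounded⇒boundedWidth : ∀ 𝒢 → TwωBounded 𝒢
  → Σ (ℕ → ℕ) λ g → ∀ G → 𝒢 G → ∀ W m → ωAtMost G W m → TwAtMost (induced G W) (g m)
twωBounded⇒boundedWidth 𝒢 (f , tw≤f) = maxUpTo , width
  where
  maxUpTo : ℕ → ℕ
  maxUpTo zero    = f zero
  maxUpTo (suc m) = f (suc m) ⊔ maxUpTo m

  f≤maxUpTo : ∀ {w} m → w ≤ m → f w ≤ maxUpTo m
  f≤maxUpTo zero z≤n = ≤-refl
  f≤maxUpTo {w} (suc m) w≤ with w ≟ suc m
  ... | yes refl = m≤m⊔n _ _
  ... | no w≢    = ≤-trans (f≤maxUpTo m (≤-pred (≤∧≢⇒< w≤ w≢))) (m≤n⊔m (f (suc m)) _)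

  width : ∀ G → 𝒢 G → ∀ W m → ωAtMost G W m → TwAtMost (induced G W) (maxUpTo m)
  width G G∈ W m ω≤m
    with cliqueNumber≤ (induced G W) m (induced-ω G W ω≤m)
  ... | w , w≤m , cn with tw≤f G G∈ (induced G W) (induced-≤ᵢ G W) w cn
  ...   | D , small = D , λ t → ≤-trans (small t) (s≤s (f≤maxUpTo m w≤m))

-- A vertex outside `M` lies in every bag, so its subtree is the whole tree and its edges are
-- covered wherever the other end lies. Vertices of `M` keep their old nodes.
extendDecomposition : ∀ G M → TreeDecomposition (induced G M) → TreeDecomposition G
extendDecomposition G M D = record
  { T       = T D
  ; isTree  = isTree D
  ; bag     = B
  ; covV    = coverV
  ; covE    = coverE
  ; subtree = connected
  }
  where
  B : Fin (n (T D)) → Subset (n G)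
  B t = image (elem M) (bag D t) ∪ ∁ M

  outside∈ : ∀ {v} t → v ∉ M → v ∈ B t
  outside∈ t v∉M = x∈p∪q⁺ (inj₂ (x∉p⇒x∈∁p v∉M))

  inside∈ : ∀ {i t} → i ∈ bag D t → elem M i ∈ B t
  inside∈ i∈ = x∈p∪q⁺ (inj₁ (∈-image⁺ (elem M) _ i∈))

  coverV : ∀ v → ∃ λ t → v ∈ B t
  coverV v with v ∈? M
  ... | no v∉M = fromℕ< (proj₁ (isTree D)) , outside∈ _ v∉M
  ... | yes v∈M with elem-surjective M v∈M
  ...   | i , refl = let t , i∈t = covV D i in t , inside∈ i∈t

  coverE : ∀ u v → adj G u v ≡ true → ∃ λ t → u ∈ B t × v ∈ B t
  coverE u v uv with u ∈? M | v ∈? M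
  ... | no u∉M | _ = let t , v∈t = coverV v in t , outside∈ t u∉M , v∈t
  ... | yes _ | no v∉M = let t , u∈t = coverV u in t , u∈t , outside∈ t v∉M
  ... | yes u∈M | yes v∈M with elem-surjective M u∈M | elem-surjective M v∈M
  ...   | i , refl | j , refl = let t , i∈t , j∈t = covE D i j uv in t , inside∈ i∈t , inside∈ j∈t

  connected : ∀ v → ConnectedOn (T D) (λ t → v ∈ B t)
  connected v x y v∈x v∈y with v ∈? M
  ... | no v∉M = mapWalk (λ {t} _ → outside∈ t v∉M) (proj₁ (proj₂ (isTree D)) x y tt tt)
  ... | yes v∈M with elem-surjective M v∈M
  ...   | i , refl = mapWalk inside∈ (subtree D i x y (strip v∈x) (strip v∈y))
    where
    strip : ∀ {t} → elem M i ∈ B t → i ∈ bag D t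
    strip {t} ∈t with x∈p∪q⁻ (image (elem M) (bag D t)) (∁ M) ∈t
    ... | inj₂ ∉M = contradiction v∈M (x∈∁p⇒x∉p ∉M)
    ... | inj₁ ∈image with ∈-image⁻ (elem M) (bag D t) ∈image
    ...   | j , j∈ , eq = subst (_∈ bag D t) (elem-injective M eq) j∈

twωBounded⇒boundedTreeα : ∀ 𝒢 → Hereditary 𝒢 → Σ Graph (λ H → IsCliquePartition H × ¬ 𝒢 H)
  → TwωBounded 𝒢 → BoundedTreeα 𝒢
twωBounded⇒boundedTreeα 𝒢 her (H , cp@(c , _) , H∉) twω
  with twωBounded⇒boundedWidth 𝒢 twω | labels<bound c
... | g , width | s , c<s = suc (g m) + b , treeα
  where
  m b : ℕ
  m = n H
  -- The Erdős-Pósa bound for `s` cliques. The inner `suc m` is the clique number allowed after an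
  -- independent set is added to `M`, the outer `suc` turns width into bag size.
  b = s * suc (g (suc m))

  enlarge : ∀ G → 𝒢 G → ∀ M → ωAtMost G M m → ∀ J → J ⊆ ∁ M → IsIndependent G J → b < ∣ J ∣
    → ¬ ¬ ∃ λ M′ → ωAtMost G M′ m × ∣ M ∣ < ∣ M′ ∣
  enlarge G G∈ M ω≤m J J⊆ ind b<J noM′ =
    erdősPósa D small s LargeClique proj₁ noFamily λ (Z , Z≤b , hit) →
      -- `Z` consists of vertices of `GW`; the image of its complement is `W` without `Z`, seen in
      -- `G`.
      noM′ (image (elem W) (∁ Z) , ω-remaining Z hit , larger Z Z≤b)
    where
    W : Subset (n G)
    W = M ∪ J

    ω≤1+m : ωAtMost G W (suc m)
    ω≤1+m S S⊆W cl = begin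
      ∣ S ∣                     ≤⟨ ∣∣-cover S M J (x∈p∪q⁻ M J ∘ S⊆W) ⟩
      ∣ S ∩ M ∣ + ∣ S ∩ J ∣     ≤⟨ +-mono-≤ (ω≤m (S ∩ M) (proj₂ ∘ x∈p∩q⁻ S M)
                                             (IsClique-⊆ G (proj₁ ∘ x∈p∩q⁻ S M) cl))
                                           (clique∩independent≤1 G cl ind) ⟩
      m + 1                     ≡⟨ +-comm m 1 ⟩
      suc m                     ∎
      where open ≤-Reasoning

    GW : Graph
    GW = induced G W

    D : TreeDecomposition GW
    D = proj₁ (width G G∈ W (suc m) ω≤1+m)

    small : ∀ t → ∣ bag D t ∣ ≤ suc (g (suc m))
    small = proj₂ (width G G∈ W (suc m) ω≤1+m)

    LargeClique : Subset (n GW) → Set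
    LargeClique K = IsClique GW K × m < ∣ K ∣

    noFamily : ¬ PairwiseAnticomplete GW s LargeClique
    -- Such a family would embed `H` in `GW`, and heredity would put `H` into the class.
    noFamily (K , FK , anti) = H∉ (her GW H (her G GW G∈ (induced-≤ᵢ G W))
      (embedCliquePartition H GW cp s c<s (K , (λ i → proj₁ (FK i) , <⇒≤ (proj₂ (FK i))) , anti)))

    ω-remaining : ∀ Z → (∀ K → LargeClique K → ∃ λ v → v ∈ K × v ∈ Z)
      → ωAtMost G (image (elem W) (∁ Z)) m
    -- A clique with more than `m` vertices pulls back to a large clique of `GW`; this meets `Z`,
    -- although it lies in the complement of `Z`.
    ω-remaining Z hit S S⊆ cl = ≮⇒≥ λ m<S →
      let z , z∈ , z∈Z = hit (preimage (elem W) S)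
            ( preimage-clique {GW} {G} (induced-≤ᵢ G W) cl
            , <-≤-trans m<S (∣∣-injection S (preimage (elem W) S)
                (λ x∈S → proj₁ (∈-image⁻ (elem W) (∁ Z) (S⊆ x∈S)))
                (λ x∈S → ∈-preimage⁺ (elem W) S (subst (_∈ S) (≡-sym (origin x∈S)) x∈S))
                (λ x∈S y∈S eq → trans (≡-sym (origin x∈S)) (trans (cong (elem W) eq) (origin y∈S)))))
          i , i∈∁Z , eq = ∈-image⁻ (elem W) (∁ Z) (S⊆ (∈-preimage⁻ (elem W) S z∈))
      in x∈∁p⇒x∉p i∈∁Z (subst (_∈ Z) (≡-sym (elem-injective W eq)) z∈Z)
      where
      origin : ∀ {x} (x∈S : x ∈ S) → elem W (proj₁ (∈-image⁻ (elem W) (∁ Z) (S⊆ x∈S))) ≡ x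
      origin x∈S = proj₂ (proj₂ (∈-image⁻ (elem W) (∁ Z) (S⊆ x∈S)))

    larger : ∀ Z → ∣ Z ∣ ≤ b → ∣ M ∣ < ∣ image (elem W) (∁ Z) ∣
    larger Z Z≤b = begin-strict
      ∣ M ∣                         ≡⟨ ≡-sym (m+n∸n≡m ∣ M ∣ b) ⟩
      -- The strict gain: `J` adds more than `b` vertices and deleting `Z` costs at most `b`.
      ∣ M ∣ + b ∸ b                 <⟨ ∸-monoˡ-< (+-monoʳ-< ∣ M ∣ b<J) (m≤n+m b ∣ M ∣) ⟩
      ∣ M ∣ + ∣ J ∣ ∸ b             ≤⟨ ∸-monoˡ-≤ b (disjoint⇒∣p∣+∣q∣≤∣p∪q∣ M J λ x∈M x∈J →
                                         x∈∁p⇒x∉p (J⊆ x∈J) x∈M) ⟩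
      ∣ W ∣ ∸ b                     ≤⟨ ∸-monoʳ-≤ ∣ W ∣ Z≤b ⟩
      ∣ W ∣ ∸ ∣ Z ∣                 ≡⟨ ≡-sym (∣∁p∣≡n∸∣p∣ Z) ⟩
      ∣ ∁ Z ∣                       ≤⟨ ≤∣image∣ (elem W) (elem-injective W) (∁ Z) ⟩
      ∣ image (elem W) (∁ Z) ∣      ∎
      where open ≤-Reasoning

  -- Replace `M` by a larger admissible set while there is one. The size grows each time and is at
  -- most `n G`, which the fuel records; when the search fails, `enlarge` bounds the independent
  -- sets outside `M`.
  maximal : ∀ G → 𝒢 G → ∀ fuel M → ωAtMost G M m → n G ≤ ∣ M ∣ + fuel
    → ∃ λ M → ωAtMost G M m × αAtMost G (∁ M) b
  maximal G G∈ fuel M ω≤m n≤ with anySubset? (λ M′ → ωAtMost? G m M′ ×-dec (∣ M ∣ <? ∣ M′ ∣))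
  ... | no none = M , ω≤m , λ J J⊆ ind → ≮⇒≥ λ b<J → enlarge G G∈ M ω≤m J J⊆ ind b<J none
  maximal G G∈ zero M ω≤m n≤ | yes (M′ , _ , M<M′) =
    contradiction (<-≤-trans M<M′ (∣p∣≤n M′)) (≤⇒≯ (subst (n G ≤_) (+-identityʳ ∣ M ∣) n≤))
  maximal G G∈ (suc fuel) M ω≤m n≤ | yes (M′ , ω≤m′ , M<M′) =
    maximal G G∈ fuel M′ ω≤m′ (≤-trans (subst (n G ≤_) (+-suc ∣ M ∣ fuel) n≤) (+-monoˡ-≤ fuel M<M′))

  treeα : ∀ G → 𝒢 G → TreeαAtMost G (suc (g m) + b)
  treeα G G∈
    with maximal G G∈ (n G) ∅ (λ S S⊆∅ _ → ≤-trans (p⊆q⇒∣p∣≤∣q∣ S⊆∅) (≤-trans (≤-reflexive (∣⊥∣≡0 (n G))) z≤n))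
           (m≤n+m _ _)
  ... | M , ω≤m , α≤b with width G G∈ M m ω≤m
  ...   | D , small = extendDecomposition G M D , λ t S S⊆ ind →
    let I = image (elem M) (bag D t) in
    -- The part of `S` in the old bag is bounded by the bag size, the part outside `M` by the choice
    -- of `M`.
    ≤-trans (∣∣-cover S I (∁ M) (x∈p∪q⁻ I (∁ M) ∘ S⊆))
      (+-mono-≤
        (≤-trans (∣p∩q∣≤∣q∣ S I) (≤-trans (∣image∣≤ (elem M) (bag D t)) (small t)))
        (α≤b (S ∩ ∁ M) (proj₂ ∘ x∈p∩q⁻ S (∁ M)) (IsIndependent-⊆ G (proj₁ ∘ x∈p∩q⁻ S (∁ M)) ind)))

theorem3p2 : (𝒢 : GraphClass) → Hereditary 𝒢
    → Σ Graph (λ H → IsCliquePartition H × ¬ 𝒢 H)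
    → (TwωBounded 𝒢 → BoundedTreeα 𝒢) × (BoundedTreeα 𝒢 → TwωBounded 𝒢)
theorem3p2 𝒢 her omitted = twωBounded⇒boundedTreeα 𝒢 her omitted , boundedTreeα⇒twωBounded 𝒢 her
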